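{- Let $G$ be a (simple) graph which consists of internally disjoint paths $P_1,\dots,P_t$ that all have the same endpoints $x$ and $y$. If $t\le3$, then $G$ is not canceling.
   Context: A signing of $G$ is a map $\sigma:E(G)\to\{\pm1\}$; for a path $P$, $\sigma(P)=\sum_{e\in P}\sigma(e)$; $d_\sigma(u,v)=\min_P|\sigma(P)|$ over all $uv$-paths $P$ in $G$ ($\infty$ if none exists, $0$ if $u=v$); $W_\sigma(G)=\frac12\sum_{u,v\in V(G)}d_\sigma(u,v)$. $G$ is canceling if some signing $\sigma$ has $W_\sigma(G)=0$. -}

module Defs where

open import Data.Nat using (ℕ; _≤_)
open import Data.Fin using (Fin)
open import Data.Bool using (Bool; true; false)
open import Data.Sign using (Sign)
open import Data.Integer using (ℤ; +_; -_; _+_; ∣_∣)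
open import Data.List using (List; []; _∷_)
open import Data.List.Relation.Unary.Unique.Propositional using (Unique)
open import Data.List.Membership.Propositional using (_∈_)
open import Data.Product using (Σ; _×_; ∃; ∃-syntax; _,_)
open import Data.Sum using (_⊎_)
open import Relation.Binary.PropositionalEquality using (_≡_; _≢_)

-- A finite simple graph on the vertex set Fin n:
-- symmetric, irreflexive Boolean adjacency.
record SimpleGraph (n : ℕ) : Set where
  field
    adj    : Fin n → Fin n → Bool
    sym    : ∀ u v → adj u v ≡ adj v u
    irrefl : ∀ u → adj u u ≡ false
open SimpleGraph public

Adj : ∀ {n} → SimpleGraph n → Fin n → Fin n → Set
Adj G u v = adj G u v ≡ true

-- A signing assigns a sign ±1 to every (unordered) edge; it is given as a
-- symmetric map on ordered pairs (values on non-edges are irrelevant).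
record Signing {n : ℕ} (G : SimpleGraph n) : Set where
  field
    sgn     : Fin n → Fin n → Sign
    sgn-sym : ∀ u v → sgn u v ≡ sgn v u
open Signing public

signToℤ : Sign → ℤ
signToℤ Sign.+ = + 1
signToℤ Sign.- = - (+ 1)

-- A walk from u to v, given by its vertex sequence u = v₀, v₁, …, vₖ = v,
-- consecutive vertices adjacent.
data IsWalk {n : ℕ} (G : SimpleGraph n) : Fin n → Fin n → List (Fin n) → Set where
  single : ∀ u → IsWalk G u u (u ∷ [])
  step   : ∀ {u w v vs} → Adj G u w → IsWalk G w v (w ∷ vs) → IsWalk G u v (u ∷ w ∷ vs)

-- A path: a walk with no repeated vertex.
IsPath : ∀ {n} → SimpleGraph n → Fin n → Fin n → List (Fin n) → Set
IsPath G u v P = IsWalk G u v P × Unique P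

-- σ(P) = sum of the signs of the edges of P.
σsum : ∀ {n} {G : SimpleGraph n} → Signing G → List (Fin n) → ℤ
σsum σ []               = + 0
σsum σ (u ∷ [])         = + 0
σsum σ (u ∷ w ∷ vs)     = signToℤ (sgn σ u w) + σsum σ (w ∷ vs)

-- u and w are consecutive vertices of the vertex sequence (an edge used by it).
data Consec {n : ℕ} (u w : Fin n) : List (Fin n) → Set where
  here  : ∀ {vs} → Consec u w (u ∷ w ∷ vs)
  there : ∀ {x vs} → Consec u w vs → Consec u w (x ∷ vs)

-- d_σ(u,v) = 0, i.e. min over uv-paths P of |σ(P)| equals 0
-- (for u = v the trivial path gives 0; if no path exists d = ∞ ≠ 0).
DistZero : ∀ {n} {G : SimpleGraph n} → Signing G → Fin n → Fin n → Set
DistZero {G = G} σ u v = ∃[ P ] (IsPath G u v P × ∣ σsum σ P ∣ ≡ 0)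

-- W_σ(G) = ½ Σ_{u,v} d_σ(u,v) = 0; since every d_σ(u,v) ∈ ℕ ∪ {∞} is
-- nonnegative, this is exactly: d_σ(u,v) = 0 for all u, v.
WZero : ∀ {n} {G : SimpleGraph n} → Signing G → Set
WZero {n} σ = (u v : Fin n) → DistZero σ u v

Canceling : ∀ {n} → SimpleGraph n → Set
Canceling G = ∃[ σ ] WZero {G = G} σ

-- G consists of the internally disjoint x–y paths P₁,…,Pₜ (x ≠ y):
-- each Pᵢ is an x–y path of G, distinct paths share only x and y,
-- every vertex of G lies on some Pᵢ and every edge of G is an edge of some Pᵢ.
record ConsistsOfPaths {n : ℕ} (G : SimpleGraph n) (x y : Fin n) (t : ℕ)
                       (P : Fin t → List (Fin n)) : Set where
  field
    endpoints-distinct : x ≢ y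
    paths              : ∀ i → IsPath G x y (P i)
    internally-disjoint : ∀ i j → i ≢ j → ∀ v → v ∈ P i → v ∈ P j → v ≡ x ⊎ v ≡ y
    cover-vertices     : ∀ v → ∃[ i ] (v ∈ P i)
    cover-edges        : ∀ u w → Adj G u w → ∃[ i ] (Consec u w (P i) ⊎ Consec w u (P i))

-- Every vertex other than x and y has degree two, so a path that enters some Pᵢ has to follow
-- it to an end. Hence every x–y path is one of the Pₖ, and a zero-weight u–v path other than
-- the edge itself, for an edge uv of Pₖ, runs back along Pₖ to x, along some Pⱼ to y and back
-- along Pₖ to v, which forces σ(uv) = σ(Pₖ) + σ(Pⱼ). If σ is canceling, some σ(Pₐ) = 0; since
-- Pₐ has edges of both signs, the weights +1 and −1 occur as well, and for t ≤ 3 these three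
-- paths are all of them, so every weight lies in {−1, 0, 1}. Then every edge of the path of
-- weight c ∈ {±1} has sign c, so that path is the single edge xy, which would carry both signs.
module Submission where

open import Defs hiding (sym)
open import Data.Nat using (ℕ; zero; suc; _≤_; s≤s)
open import Data.Fin using (Fin; zero; suc; _≟_)
import Data.Fin as Fin
open import Data.Fin.Properties using (pigeonhole)
open import Data.Sign using (Sign; opposite)
open import Data.Sign.Properties using (s≢opposite[s])
open import Data.Integer using (ℤ; +_; _+_; _◃_)
open import Data.Integer.Properties using (+-identityˡ; +-identityʳ; +-assoc; +-comm; ∣i∣≡0⇒i≡0)
open import Data.List using (List; []; _∷_; _++_; _∷ʳ_; [_]; reverse; length)
open import Data.List.Properties using (++-assoc; ∷-injective; unfold-reverse; reverse-++; reverse-involutive)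
open import Data.List.Relation.Unary.Any using (here; there)
open import Data.List.Relation.Unary.Any.Properties using (reverse⁺; reverse⁻)
open import Data.List.Relation.Unary.All using (lookup)
open import Data.List.Relation.Unary.AllPairs using (_∷_)
open import Data.List.Relation.Unary.Unique.Propositional using (Unique)
open import Data.List.Relation.Unary.Unique.Propositional.Properties using (Unique[x∷xs]⇒x∉xs)
open import Data.List.Membership.Propositional using (_∈_; _∉_)
open import Data.List.Membership.Propositional.Properties using (∈-++⁺ˡ; ∈-++⁺ʳ)
import Data.List.Relation.Binary.Permutation.Setoid as Permutation
import Data.List.Relation.Binary.Permutation.Setoid.Properties as Permutationₚ
open import Data.Product using (_×_; ∃-syntax; _,_; proj₁; proj₂)
import Data.Product as Product
open import Data.Sum using (_⊎_; inj₁; inj₂)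
import Data.Sum as Sum
open import Function using (_∘_)
open import Data.Empty using (⊥-elim)
open import Data.Integer.Solver using (module +-*-Solver)
open import Relation.Nullary using (¬_; yes; no)
open import Relation.Binary.PropositionalEquality using (_≡_; _≢_; refl; sym; trans; cong; cong₂; subst; setoid; module ≡-Reasoning)

module _ {A : Set} where

  Unique-reverse : ∀ {xs : List A} → Unique xs → Unique (reverse xs)
  Unique-reverse {xs} = Unique-resp-↭ (↭-sym (↭-reverse xs))
    where open Permutation (setoid A) using (↭-sym)
          open Permutationₚ (setoid A) using (Unique-resp-↭; ↭-reverse)

  Unique-++⁻ʳ : ∀ xs {ys : List A} → Unique (xs ++ ys) → Unique ys
  Unique-++⁻ʳ []       u       = u
  Unique-++⁻ʳ (_ ∷ xs) (_ ∷ u) = Unique-++⁻ʳ xs u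

  Unique-++-disjoint : ∀ xs {ys : List A} {z} → Unique (xs ++ ys) → z ∈ xs → z ∉ ys
  Unique-++-disjoint (_ ∷ xs) (x∉ ∷ _) (here refl) z∈ys = lookup x∉ (∈-++⁺ʳ xs z∈ys) refl
  Unique-++-disjoint (_ ∷ xs) (_ ∷ u)  (there z∈xs)     = Unique-++-disjoint xs u z∈xs

  unique-position : ∀ {L : List A} {z} xs ys xs′ ys′ → Unique L →
                    L ≡ xs ++ z ∷ ys → L ≡ xs′ ++ z ∷ ys′ → xs ≡ xs′ × ys ≡ ys′
  unique-position []       _  []        _   _        refl refl = refl , refl
  unique-position []       _  (_ ∷ xs′) _   (z∉ ∷ _) refl refl = ⊥-elim (lookup z∉ (∈-++⁺ʳ xs′ (here refl)) refl)
  unique-position (_ ∷ xs) _  []        _   (z∉ ∷ _) refl refl = ⊥-elim (lookup z∉ (∈-++⁺ʳ xs (here refl)) refl)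
  unique-position (a ∷ xs) ys (_ ∷ xs′) ys′ (_ ∷ u)  refl eq with ∷-injective eq
  ... | refl , eq′ = Product.map₁ (cong (a ∷_)) (unique-position xs ys xs′ ys′ u refl eq′)

  reverse-++-∷ : ∀ (xs : List A) z ys → reverse (xs ++ z ∷ ys) ≡ reverse ys ++ z ∷ reverse xs
  reverse-++-∷ xs z ys = trans (reverse-++ xs (z ∷ ys))
    (trans (cong (_++ reverse xs) (unfold-reverse z ys)) (++-assoc (reverse ys) [ z ] (reverse xs)))

  reverse-∷-∷ʳ : ∀ (a : A) xs b → reverse ((a ∷ xs) ∷ʳ b) ≡ (b ∷ reverse xs) ∷ʳ a
  reverse-∷-∷ʳ a xs b = trans (reverse-++ (a ∷ xs) [ b ]) (cong (b ∷_) (unfold-reverse a xs))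

  reverse-around : ∀ {L p S} (a : A) xs u v ys → L ≡ (a ∷ xs) ++ u ∷ v ∷ ys → reverse xs ∷ʳ a ≡ p ∷ S →
                   reverse L ≡ reverse ys ++ v ∷ u ∷ p ∷ S
  reverse-around a xs u v ys refl e = begin
    reverse ((a ∷ xs) ++ u ∷ v ∷ ys)          ≡⟨ cong reverse (sym (++-assoc (a ∷ xs) [ u ] (v ∷ ys))) ⟩
    reverse (((a ∷ xs) ∷ʳ u) ++ v ∷ ys)       ≡⟨ reverse-++-∷ ((a ∷ xs) ∷ʳ u) v ys ⟩
    reverse ys ++ v ∷ reverse ((a ∷ xs) ∷ʳ u) ≡⟨ cong (λ M → reverse ys ++ v ∷ M) (trans (reverse-∷-∷ʳ a xs u) (cong (u ∷_) e)) ⟩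
    reverse ys ++ v ∷ u ∷ _ ∷ _               ∎
    where open ≡-Reasoning

  ∷ʳ-uncons : ∀ (xs : List A) z → ∃[ p ] ∃[ S ] (xs ∷ʳ z ≡ p ∷ S)
  ∷ʳ-uncons []       z = z , [] , refl
  ∷ʳ-uncons (p ∷ xs) z = p , xs ∷ʳ z , refl

  ∈-split : ∀ {L : List A} {v} xs ys → L ≡ xs ++ v ∷ ys → v ∈ L
  ∈-split xs _ refl = ∈-++⁺ʳ xs (here refl)

  head-∈-init : ∀ {a b : A} {T} Z → a ≢ b → a ∷ T ≡ Z ∷ʳ b → a ∈ Z
  head-∈-init []      a≢b e = ⊥-elim (a≢b (proj₁ (∷-injective e)))
  head-∈-init (_ ∷ _) _   e = here (proj₁ (∷-injective e))

three-cover : ∀ {t} → t ≤ 3 → {i j k : Fin t} → i ≢ j → i ≢ k → j ≢ k → ∀ l → l ≡ i ⊎ l ≡ j ⊎ l ≡ k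
three-cover {t} t≤3 {i} {j} {k} i≢j i≢k j≢k l with l ≟ i | l ≟ j | l ≟ k
... | yes l≡i | _        | _        = inj₁ l≡i
... | no _    | yes l≡j  | _        = inj₂ (inj₁ l≡j)
... | no _    | no _     | yes l≡k  = inj₂ (inj₂ l≡k)
... | no l≢i  | no l≢j   | no l≢k   = ⊥-elim (no-collision (pigeonhole (s≤s t≤3) f))
  where
    f : Fin 4 → Fin t
    f zero                   = i
    f (suc zero)             = j
    f (suc (suc zero))       = k
    f (suc (suc (suc zero))) = l
    no-collision : ¬ (∃[ p ] ∃[ q ] (p Fin.< q × f p ≡ f q))
    no-collision (zero , suc zero , _ , e)                         = i≢j e
    no-collision (zero , suc (suc zero) , _ , e)                   = i≢k e
    no-collision (zero , suc (suc (suc zero)) , _ , e)             = l≢i (sym e)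
    no-collision (suc zero , suc (suc zero) , _ , e)               = j≢k e
    no-collision (suc zero , suc (suc (suc zero)) , _ , e)         = l≢j (sym e)
    no-collision (suc (suc zero) , suc (suc (suc zero)) , _ , e)   = l≢k (sym e)
    no-collision (zero , zero , () , _)
    no-collision (suc zero , zero , () , _)
    no-collision (suc zero , suc zero , s≤s () , _)
    no-collision (suc (suc zero) , zero , () , _)
    no-collision (suc (suc zero) , suc zero , s≤s () , _)
    no-collision (suc (suc zero) , suc (suc zero) , s≤s (s≤s ()) , _)
    no-collision (suc (suc (suc zero)) , zero , () , _)
    no-collision (suc (suc (suc zero)) , suc zero , s≤s () , _)
    no-collision (suc (suc (suc zero)) , suc (suc zero) , s≤s (s≤s ()) , _)
    no-collision (suc (suc (suc zero)) , suc (suc (suc zero)) , s≤s (s≤s (s≤s ())) , _)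

signToℤ-+-◃ : ∀ c m → signToℤ c + (c ◃ m) ≡ c ◃ suc m
signToℤ-+-◃ Sign.+ zero    = refl
signToℤ-+-◃ Sign.+ (suc m) = refl
signToℤ-+-◃ Sign.- zero    = refl
signToℤ-+-◃ Sign.- (suc m) = refl

◃-suc≢0 : ∀ c m → c ◃ suc m ≢ + 0
◃-suc≢0 Sign.+ m ()
◃-suc≢0 Sign.- m ()

signToℤ≢0 : ∀ c → signToℤ c ≢ + 0
signToℤ≢0 Sign.+ ()
signToℤ≢0 Sign.- ()

signToℤ≢◃-suc-suc : ∀ c m → signToℤ c ≢ c ◃ suc (suc m)
signToℤ≢◃-suc-suc Sign.+ m ()
signToℤ≢◃-suc-suc Sign.- m ()

sign-dichotomy : ∀ a c → a ≡ c ⊎ a ≡ opposite c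
sign-dichotomy Sign.+ Sign.+ = inj₁ refl
sign-dichotomy Sign.+ Sign.- = inj₂ refl
sign-dichotomy Sign.- Sign.+ = inj₂ refl
sign-dichotomy Sign.- Sign.- = inj₁ refl

SignOrZero : ℤ → Set
SignOrZero z = z ≡ + 0 ⊎ ∃[ d ] (z ≡ signToℤ d)

sign-forced : ∀ c c′ z → SignOrZero z → signToℤ c′ ≡ signToℤ c + z → c′ ≡ c
sign-forced Sign.+ Sign.+ _ _                     _  = refl
sign-forced Sign.- Sign.- _ _                     _  = refl
sign-forced Sign.+ Sign.- _ (inj₁ refl)           ()
sign-forced Sign.+ Sign.- _ (inj₂ (Sign.+ , refl)) ()
sign-forced Sign.+ Sign.- _ (inj₂ (Sign.- , refl)) ()
sign-forced Sign.- Sign.+ _ (inj₁ refl)           ()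
sign-forced Sign.- Sign.+ _ (inj₂ (Sign.+ , refl)) ()
sign-forced Sign.- Sign.+ _ (inj₂ (Sign.- , refl)) ()

cancel-detour : ∀ a e b q → a + (q + b) ≡ + 0 → e ≡ (a + (e + b)) + q
cancel-detour a e b q h = begin
  e                  ≡⟨ sym (+-identityʳ e) ⟩
  e + + 0            ≡⟨ cong (λ z → e + z) (sym h) ⟩
  e + (a + (q + b))  ≡⟨ solve 4 (λ a e b q → e :+ (a :+ (q :+ b)) := (a :+ (e :+ b)) :+ q) refl a e b q ⟩
  (a + (e + b)) + q  ∎
  where open ≡-Reasoning
        open +-*-Solver using (solve; _:+_; _:=_)

module _ {n : ℕ} where

  consec-∈₁ : ∀ {u w : Fin n} {L} → Consec u w L → u ∈ L
  consec-∈₁ here      = here refl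
  consec-∈₁ (there c) = there (consec-∈₁ c)

  consec-∈₂ : ∀ {u w : Fin n} {L} → Consec u w L → w ∈ L
  consec-∈₂ here      = there (here refl)
  consec-∈₂ (there c) = there (consec-∈₂ c)

  consec-∈-tail : ∀ {u w a : Fin n} {L} → Consec u w (a ∷ L) → w ∈ L
  consec-∈-tail here      = here refl
  consec-∈-tail (there c) = consec-∈₂ c

  consec-∈-init : ∀ {u w a : Fin n} L → Consec u w (L ∷ʳ a) → u ∈ L
  consec-∈-init []              (there ())
  consec-∈-init (_ ∷ [])         here              = here refl
  consec-∈-init (_ ∷ [])         (there (there ()))
  consec-∈-init (_ ∷ _ ∷ _)      here              = here refl
  consec-∈-init (_ ∷ L@(_ ∷ _)) (there c)         = there (consec-∈-init L c)

  consec-split : ∀ {u w : Fin n} {L} → Consec u w L → ∃[ A ] ∃[ B ] (L ≡ A ++ u ∷ w ∷ B)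
  consec-split here = [] , _ , refl
  consec-split (there {x = a} c) = Product.map (a ∷_) (Product.map₂ (cong (a ∷_))) (consec-split c)

  consec-++ˡ : ∀ {u w : Fin n} {xs} ys → Consec u w xs → Consec u w (xs ++ ys)
  consec-++ˡ ys here      = here
  consec-++ˡ ys (there c) = there (consec-++ˡ ys c)

  consec-++ʳ : ∀ {u w : Fin n} xs {ys} → Consec u w ys → Consec u w (xs ++ ys)
  consec-++ʳ []       c = c
  consec-++ʳ (_ ∷ xs) c = there (consec-++ʳ xs c)

  consec-reverse : ∀ {u w : Fin n} {L} → Consec u w L → Consec w u (reverse L)
  consec-reverse {u} {w} (here {vs = vs}) =
    subst (Consec w u) (sym (begin
      reverse (u ∷ w ∷ vs)      ≡⟨ unfold-reverse u (w ∷ vs) ⟩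
      reverse (w ∷ vs) ∷ʳ u     ≡⟨ cong (_∷ʳ u) (unfold-reverse w vs) ⟩
      (reverse vs ∷ʳ w) ∷ʳ u    ≡⟨ ++-assoc (reverse vs) [ w ] [ u ] ⟩
      reverse vs ++ w ∷ u ∷ []  ∎))
      (consec-++ʳ (reverse vs) here)
    where open ≡-Reasoning
  consec-reverse (there {x = a} {vs = vs} c) =
    subst (Consec _ _) (sym (unfold-reverse a vs)) (consec-++ˡ [ a ] (consec-reverse c))

  consec-reverse⁻ : ∀ {u w : Fin n} {L} → Consec u w (reverse L) → Consec w u L
  consec-reverse⁻ {L = L} c = subst (Consec _ _) (reverse-involutive L) (consec-reverse c)

  consec-successor-unique : ∀ {b c d : Fin n} {L} → Unique L → Consec b c L → Consec b d L → c ≡ d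
  consec-successor-unique _           here       here       = refl
  consec-successor-unique (b∉ ∷ _)    here       (there c′) = ⊥-elim (lookup b∉ (consec-∈₁ c′) refl)
  consec-successor-unique (b∉ ∷ _)    (there c)  here       = ⊥-elim (lookup b∉ (consec-∈₁ c) refl)
  consec-successor-unique (_ ∷ u)     (there c)  (there c′) = consec-successor-unique u c c′

  consec-predecessor-unique : ∀ {a b c : Fin n} {L} → Unique L → Consec a b L → Consec c b L → a ≡ c
  consec-predecessor-unique _                 here      here       = refl
  consec-predecessor-unique (_ ∷ b∉ ∷ _)     here      (there c′) = ⊥-elim (lookup b∉ (consec-∈-tail c′) refl)
  consec-predecessor-unique (_ ∷ b∉ ∷ _)     (there c) here       = ⊥-elim (lookup b∉ (consec-∈-tail c) refl)
  consec-predecessor-unique (_ ∷ u)           (there c) (there c′) = consec-predecessor-unique u c c′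

  consec-head : ∀ {u w : Fin n} {T} → Unique (u ∷ T) → Consec u w (u ∷ T) → ∃[ S ] (T ≡ w ∷ S)
  consec-head _          here      = _ , refl
  consec-head (u∉ ∷ _)   (there c) = ⊥-elim (lookup u∉ (consec-∈₁ c) refl)

-- A record rather than a function type, so that L can be inferred from Unbranched G L.
record Unbranched {n} (G : SimpleGraph n) (L : List (Fin n)) : Set where
  constructor unbranched
  field neighbours : ∀ {a b c d} → Consec a b L → Consec b c L → Adj G b d → d ≡ a ⊎ d ≡ c
open Unbranched

module _ {n : ℕ} {G : SimpleGraph n} where

  walk-start : ∀ {u v L} → IsWalk G u v L → ∃[ T ] (L ≡ u ∷ T)
  walk-start (single u) = [] , refl
  walk-start (step _ _) = _ , refl

  walk-end : ∀ {u v L} → IsWalk G u v L → ∃[ Z ] (L ≡ Z ∷ʳ v)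
  walk-end (single u)         = [] , refl
  walk-end (step {u = u} _ w) = Product.map (u ∷_) (cong (u ∷_)) (walk-end w)

  walk-end-∈ : ∀ {u v L} → IsWalk G u v L → v ∈ L
  walk-end-∈ w with walk-end w
  ... | Z , refl = ∈-++⁺ʳ Z (here refl)

  walk-suffix : ∀ xs {u v z ys} → IsWalk G u v (xs ++ z ∷ ys) → IsWalk G z v (z ∷ ys)
  walk-suffix []            (single u) = single u
  walk-suffix []            (step a w) = step a w
  walk-suffix (_ ∷ [])      (step _ w) = w
  walk-suffix (_ ∷ x ∷ xs)  (step _ w) = walk-suffix (x ∷ xs) w

  path-suffix : ∀ xs {u v z ys} → IsPath G u v (xs ++ z ∷ ys) → IsPath G z v (z ∷ ys)
  path-suffix xs (w , uq) = walk-suffix xs w , Unique-++⁻ʳ xs uq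

  walk-end-∈-extension : ∀ {u v Q R L} → IsWalk G u v Q → Q ++ R ≡ L → v ∈ L
  walk-end-∈-extension w refl = ∈-++⁺ˡ (walk-end-∈ w)

  closed-path-trivial : ∀ {u L} → IsPath G u u L → L ≡ [ u ]
  closed-path-trivial (w , uq) with walk-start w | walk-end w
  ... | T , refl | Z , e with unique-position [] T Z [] uq refl e
  ... | _ , refl = refl

  nontrivial-path-endpoints-distinct : ∀ {u v w Q} → IsPath G u v (u ∷ w ∷ Q) → u ≢ v
  nontrivial-path-endpoints-distinct p refl with closed-path-trivial p
  ... | ()

  path-start-has-no-predecessor : ∀ {u v w L} → IsPath G u v L → ¬ Consec w u L
  path-start-has-no-predecessor (w , uq) c with walk-start w
  ... | _ , refl = Unique[x∷xs]⇒x∉xs uq (consec-∈-tail c)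

  path-first-edge : ∀ {u v w L} → IsPath G u v L → Consec u w L → ∃[ S ] (L ≡ u ∷ w ∷ S)
  path-first-edge (w , uq) c with walk-start w
  ... | _ , refl = Product.map₂ (cong (_ ∷_)) (consec-head uq c)

  path-last-edge : ∀ {u v w L} → IsPath G u v L → Consec w v L → ∃[ S ] (reverse L ≡ v ∷ w ∷ S)
  path-last-edge {v = v} {w} (wk , uq) c with walk-end wk
  ... | Z , refl = Product.map₂ (λ e → trans rev (cong (v ∷_) e))
                     (consec-head (subst Unique rev (Unique-reverse uq)) (subst (Consec v w) rev (consec-reverse c)))
    where rev = reverse-++ Z [ v ]

  prefix-walk-ending-at : ∀ {L u v A B Q R} → Unique L → L ≡ A ++ v ∷ B → IsWalk G u v Q → Q ++ R ≡ L → Q ≡ A ∷ʳ v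
  prefix-walk-ending-at {v = v} {A} {B} {R = R} uq e w e′ with walk-end w
  ... | Q₀ , refl = cong (_∷ʳ v) (proj₁ (unique-position Q₀ R A B uq (trans (sym e′) (++-assoc Q₀ [ v ] R)) e))

  path-end-has-no-successor : ∀ {u v w L} → IsPath G u v L → ¬ Consec v w L
  path-end-has-no-successor (w , uq) c with walk-end w
  ... | Z , refl = Unique-++-disjoint Z uq (consec-∈-init Z c) (here refl)

  Unbranched-++⁻ʳ : ∀ xs {L} → Unbranched G (xs ++ L) → Unbranched G L
  Unbranched-++⁻ʳ xs B = unbranched λ c₁ c₂ → neighbours B (consec-++ʳ xs c₁) (consec-++ʳ xs c₂)

  Unbranched-reverse : ∀ {L} → Unbranched G L → Unbranched G (reverse L)
  Unbranched-reverse B = unbranched λ c₁ c₂ adj → Sum.swap (neighbours B (consec-reverse⁻ c₂) (consec-reverse⁻ c₁) adj)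

  follow : ∀ {a b S Q v} → Unbranched G (a ∷ b ∷ S) → IsPath G a v (a ∷ b ∷ Q) →
           (∃[ R ] ((a ∷ b ∷ Q) ++ R ≡ a ∷ b ∷ S)) ⊎ (∃[ R ] ((a ∷ b ∷ S) ++ R ≡ a ∷ b ∷ Q))
  follow {S = S}  {Q = []}    _ _ = inj₁ (S , refl)
  follow {S = []} {Q = c ∷ Q} _ _ = inj₂ (c ∷ Q , refl)
  follow {a} {S = _ ∷ _} {Q = _ ∷ _} B (step _ w@(step adj _) , a∉ ∷ uq) with neighbours B here (there here) adj
  ... | inj₁ refl = ⊥-elim (lookup a∉ (there (here refl)) refl)
  ... | inj₂ refl = Sum.map (Product.map₂ (cong (a ∷_))) (Product.map₂ (cong (a ∷_)))
                            (follow (Unbranched-++⁻ʳ [ a ] B) (w , uq))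

module _ {n : ℕ} {G : SimpleGraph n} (σ : Signing G) where

  σsum-++ : ∀ xs z ys → σsum σ (xs ++ z ∷ ys) ≡ σsum σ (xs ∷ʳ z) + σsum σ (z ∷ ys)
  σsum-++ []           z ys = sym (+-identityˡ _)
  σsum-++ (a ∷ [])     z ys = cong (_+ σsum σ (z ∷ ys)) (sym (+-identityʳ (signToℤ (sgn σ a z))))
  σsum-++ (a ∷ b ∷ xs) z ys = trans (cong (λ s → signToℤ (sgn σ a b) + s) (σsum-++ (b ∷ xs) z ys))
                                    (sym (+-assoc (signToℤ (sgn σ a b)) _ _))

  σsum-reverse : ∀ L → σsum σ (reverse L) ≡ σsum σ L
  σsum-reverse []          = refl
  σsum-reverse (a ∷ [])    = refl
  σsum-reverse (a ∷ b ∷ L) = begin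
    σsum σ (reverse (a ∷ b ∷ L))                           ≡⟨ cong (σsum σ) (unfold-reverse a (b ∷ L)) ⟩
    σsum σ (reverse (b ∷ L) ∷ʳ a)                          ≡⟨ cong (λ M → σsum σ (M ∷ʳ a)) (unfold-reverse b L) ⟩
    σsum σ ((reverse L ∷ʳ b) ∷ʳ a)                         ≡⟨ cong (σsum σ) (++-assoc (reverse L) [ b ] [ a ]) ⟩
    σsum σ (reverse L ++ b ∷ a ∷ [])                       ≡⟨ σsum-++ (reverse L) b [ a ] ⟩
    σsum σ (reverse L ∷ʳ b) + (signToℤ (sgn σ b a) + + 0)  ≡⟨ cong (_+ _) (cong (σsum σ) (sym (unfold-reverse b L))) ⟩
    σsum σ (reverse (b ∷ L)) + (signToℤ (sgn σ b a) + + 0) ≡⟨ cong₂ _+_ (σsum-reverse (b ∷ L)) (+-identityʳ _) ⟩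
    σsum σ (b ∷ L) + signToℤ (sgn σ b a)                   ≡⟨ +-comm (σsum σ (b ∷ L)) _ ⟩
    signToℤ (sgn σ b a) + σsum σ (b ∷ L)                   ≡⟨ cong (λ s → signToℤ s + σsum σ (b ∷ L)) (sgn-sym σ b a) ⟩
    σsum σ (a ∷ b ∷ L)                                     ∎
    where open ≡-Reasoning

  edge-of-sign-or-monochromatic : ∀ c L → (∃[ u ] ∃[ w ] (Consec u w L × sgn σ u w ≡ c)) ⊎
                                            (∀ {u w} → Consec u w L → sgn σ u w ≡ opposite c)
  edge-of-sign-or-monochromatic c []          = inj₂ λ ()
  edge-of-sign-or-monochromatic c (_ ∷ [])    = inj₂ λ { (there ()) }
  edge-of-sign-or-monochromatic c (a ∷ b ∷ L) with sign-dichotomy (sgn σ a b) c | edge-of-sign-or-monochromatic c (b ∷ L)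
  ... | inj₁ ab≡c | _                    = inj₁ (a , b , here , ab≡c)
  ... | inj₂ _    | inj₁ (u , w , uw , e) = inj₁ (u , w , there uw , e)
  ... | inj₂ ab≡c̄ | inj₂ mono            = inj₂ λ { here → ab≡c̄ ; (there uw) → mono uw }

  edge-sum-nonzero : ∀ u v → σsum σ (u ∷ v ∷ []) ≢ + 0
  edge-sum-nonzero u v with sgn σ u v
  ... | Sign.+ = λ ()
  ... | Sign.- = λ ()

  σsum-monochromatic : ∀ c a L → (∀ {u w} → Consec u w (a ∷ L) → sgn σ u w ≡ c) → σsum σ (a ∷ L) ≡ c ◃ length L
  σsum-monochromatic c a []      _    = refl
  σsum-monochromatic c a (b ∷ L) mono = begin
    signToℤ (sgn σ a b) + σsum σ (b ∷ L) ≡⟨ cong₂ _+_ (cong signToℤ (mono here)) (σsum-monochromatic c b L (mono ∘ there)) ⟩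
    signToℤ c + (c ◃ length L)           ≡⟨ signToℤ-+-◃ c (length L) ⟩
    c ◃ suc (length L)                   ∎
    where open ≡-Reasoning

  zero-walk-has-edge-of-sign : ∀ {u v L} c → u ≢ v → IsWalk G u v L → σsum σ L ≡ + 0 →
                               ∃[ a ] ∃[ b ] (Consec a b L × sgn σ a b ≡ c)
  zero-walk-has-edge-of-sign {L = L} c u≢v w L≡0 with edge-of-sign-or-monochromatic c L
  ... | inj₁ edge = edge
  ... | inj₂ mono with w
  ...   | single _ = ⊥-elim (u≢v refl)
  ...   | step {u = u} {vs = vs} _ _ =
          ⊥-elim (◃-suc≢0 (opposite c) (length vs) (trans (sym (σsum-monochromatic (opposite c) u _ mono)) L≡0))

  monochromatic-walk-sign : ∀ {u v L} c → IsWalk G u v L → (∀ {a b} → Consec a b L → sgn σ a b ≡ c) →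
                            σsum σ L ≡ signToℤ c → sgn σ u v ≡ c
  monochromatic-walk-sign c (single _)            _    L≡c = ⊥-elim (signToℤ≢0 c (sym L≡c))
  monochromatic-walk-sign c (step _ (single _))   mono _   = mono here
  monochromatic-walk-sign c (step {u = u} _ (step {vs = vs} _ _)) mono L≡c =
    ⊥-elim (signToℤ≢◃-suc-suc c (length vs) (trans (sym L≡c) (σsum-monochromatic c u _ mono)))

module ThetaGraph {n : ℕ} {G : SimpleGraph n} {x y : Fin n} {t : ℕ} {P : Fin t → List (Fin n)}
             (C : ConsistsOfPaths G x y t P) where

  open ConsistsOfPaths C

  P-walk : ∀ k → IsWalk G x y (P k)
  P-walk k = proj₁ (paths k)

  P-unique : ∀ k → Unique (P k)
  P-unique k = proj₂ (paths k)

  P-init : ∀ k → ∃[ Z ] (P k ≡ Z ∷ʳ y × x ∈ Z)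
  P-init k with walk-start (P-walk k) | walk-end (P-walk k)
  ... | T , e | Z , e′ = Z , e′ , head-∈-init Z endpoints-distinct (trans (sym e) e′)

  y-is-last : ∀ {k A B} → P k ≡ A ++ y ∷ B → B ≡ []
  y-is-last {k} {A} {B} e with walk-end (P-walk k)
  ... | Z , e′ = proj₂ (unique-position A B Z [] (P-unique k) e e′)

  on-one-path : ∀ {i k v} → v ∈ P i → v ∈ P k → v ≢ x → v ≢ y → i ≡ k
  on-one-path {i} {k} {v} v∈Pi v∈Pk v≢x v≢y with i ≟ k
  ... | yes i≡k = i≡k
  ... | no i≢k with internally-disjoint i k i≢k v v∈Pi v∈Pk
  ...   | inj₁ v≡x = ⊥-elim (v≢x v≡x)
  ...   | inj₂ v≡y = ⊥-elim (v≢y v≡y)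

  interior-on-one-path : ∀ {i k a b c} → Consec a b (P k) → Consec b c (P k) → b ∈ P i → i ≡ k
  interior-on-one-path {k = k} ab bc b∈Pi = on-one-path b∈Pi (consec-∈₂ ab) b≢x b≢y
    where
      b≢x : _ ≢ x
      b≢x refl = path-start-has-no-predecessor (paths k) ab
      b≢y : _ ≢ y
      b≢y refl = path-end-has-no-successor (paths k) bc

  P-unbranched : ∀ k → Unbranched G (P k)
  P-unbranched k = unbranched neighbours-in-P
    where
      neighbours-in-P : ∀ {a b c d} → Consec a b (P k) → Consec b c (P k) → Adj G b d → d ≡ a ⊎ d ≡ c
      neighbours-in-P ab bc bd with cover-edges _ _ bd
      ... | i , inj₁ bd∈Pi with interior-on-one-path ab bc (consec-∈₁ bd∈Pi)
      ...   | refl = inj₂ (consec-successor-unique (P-unique k) bd∈Pi bc)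
      neighbours-in-P ab bc bd | i , inj₂ db∈Pi with interior-on-one-path ab bc (consec-∈₂ db∈Pi)
      ...   | refl = inj₁ (consec-predecessor-unique (P-unique k) db∈Pi ab)

  edge-at-x : ∀ {w} → Adj G x w → ∃[ i ] ∃[ S ] (P i ≡ x ∷ w ∷ S)
  edge-at-x {w} adj with cover-edges x w adj
  ... | i , inj₁ xw = i , path-first-edge (paths i) xw
  ... | i , inj₂ wx = ⊥-elim (path-start-has-no-predecessor (paths i) wx)

  edge-at-y : ∀ {w} → Adj G y w → ∃[ i ] ∃[ S ] (reverse (P i) ≡ y ∷ w ∷ S)
  edge-at-y {w} adj with cover-edges y w adj
  ... | i , inj₁ yw = ⊥-elim (path-end-has-no-successor (paths i) yw)
  ... | i , inj₂ wy = i , path-last-edge (paths i) wy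

  walk-to-y-prefix : ∀ {i u Q R} → IsWalk G u y Q → Q ++ R ≡ P i → Q ≡ P i
  walk-to-y-prefix {i} w e with walk-end (P-walk i)
  ... | Z , eZ = trans (prefix-walk-ending-at (P-unique i) eZ w e) (sym eZ)

  x∈P : ∀ k → x ∈ P k
  x∈P k = subst (x ∈_) (sym (proj₂ (walk-start (P-walk k)))) (here refl)

  path-from-y : ∀ {k A v B Q} → P k ≡ A ++ v ∷ B → IsPath G y v Q → x ∉ Q → Q ≡ reverse B ∷ʳ v
  path-from-y e (single _ , _) _ rewrite y-is-last e = refl
  path-from-y {k} {A} {v} {B} {Q} e path@(step adj _ , _) x∉Q with edge-at-y adj
  ... | i , S , eS with follow (subst (Unbranched G) eS (Unbranched-reverse (P-unbranched i))) path
  ...   | inj₂ (R , e′) = ⊥-elim (x∉Q (subst (x ∈_) e′ (∈-++⁺ˡ (subst (x ∈_) eS (reverse⁺ (x∈P i))))))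
  ...   | inj₁ (R , e′) with on-one-path (reverse⁻ (walk-end-∈-extension (proj₁ path) (trans e′ (sym eS))))
                                        (∈-split A B e) v≢x (nontrivial-path-endpoints-distinct path ∘ sym)
    where
      v≢x : v ≢ x
      v≢x v≡x = x∉Q (subst (_∈ Q) v≡x (walk-end-∈ (proj₁ path)))
  ...     | refl = prefix-walk-ending-at (Unique-reverse (P-unique k)) (trans (cong reverse e) (reverse-++-∷ A v B))
                                         (proj₁ path) (trans e′ (sym eS))

  leaves-backwards : ∀ {k B′ u v p S Q} → reverse (P k) ≡ B′ ++ v ∷ u ∷ p ∷ S → IsPath G u v Q → Q ≢ u ∷ v ∷ [] →
                     ∃[ R ] ((u ∷ p ∷ S) ++ R ≡ Q)
  leaves-backwards {k} {B′} eP (single _ , _) _ with Unique-++⁻ʳ B′ (subst Unique eP (Unique-reverse (P-unique k)))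
  ... | u∉ ∷ _ = ⊥-elim (lookup u∉ (here refl) refl)
  leaves-backwards {k} {B′} eP path@(step adj _ , _) Q≢uv
    with neighbours (Unbranched-++⁻ʳ B′ (subst (Unbranched G) eP (Unbranched-reverse (P-unbranched k)))) here (there here) adj
  ... | inj₁ refl with closed-path-trivial (path-suffix [ _ ] path)
  ...   | refl = ⊥-elim (Q≢uv refl)
  leaves-backwards {k} {B′} {u} {v} {p} {S} eP path@(step adj _ , _) Q≢uv | inj₂ refl
    with follow (Unbranched-++⁻ʳ (B′ ++ [ v ]) (subst (Unbranched G) (trans eP (sym (++-assoc B′ [ v ] (u ∷ p ∷ S))))
                                               (Unbranched-reverse (P-unbranched k)))) path
  ... | inj₂ prefix = prefix
  ... | inj₁ (R , e′) with Unique-++⁻ʳ B′ (subst Unique eP (Unique-reverse (P-unique k)))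
  ...   | v∉ ∷ _ = ⊥-elim (lookup v∉ (walk-end-∈-extension (proj₁ path) e′) refl)

  module _ (σ : Signing G) where

    σP : Fin t → ℤ
    σP k = σsum σ (P k)

    through-y : ∀ {i k A v B R Q} → P k ≡ A ++ v ∷ B → IsPath G x v Q → P i ++ R ≡ Q →
                σsum σ Q ≡ σP i + σsum σ (v ∷ B)
    through-y {i = i} {v = v} {B} {R} {Q} e path e′ with P-init i
    ... | Z , eZ , x∈Z = begin
      σsum σ Q                          ≡⟨ cong (σsum σ) (sym Q≡) ⟩
      σsum σ (Z ++ y ∷ R)               ≡⟨ σsum-++ σ Z y R ⟩
      σsum σ (Z ∷ʳ y) + σsum σ (y ∷ R)  ≡⟨ cong₂ _+_ (cong (σsum σ) (sym eZ)) back-from-y ⟩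
      σP i + σsum σ (v ∷ B)             ∎
      where
        open ≡-Reasoning
        Q≡ : Z ++ y ∷ R ≡ Q
        Q≡ = trans (sym (++-assoc Z [ y ] R)) (trans (cong (_++ R) (sym eZ)) e′)
        path′ : IsPath G x v (Z ++ y ∷ R)
        path′ = subst (IsPath G x v) (sym Q≡) path
        back-from-y : σsum σ (y ∷ R) ≡ σsum σ (v ∷ B)
        back-from-y = begin
          σsum σ (y ∷ R)           ≡⟨ cong (σsum σ) (path-from-y e (path-suffix Z path′) (Unique-++-disjoint Z (proj₂ path′) x∈Z)) ⟩
          σsum σ (reverse B ∷ʳ v)  ≡⟨ cong (σsum σ) (sym (unfold-reverse v B)) ⟩
          σsum σ (reverse (v ∷ B)) ≡⟨ σsum-reverse σ (v ∷ B) ⟩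
          σsum σ (v ∷ B)           ∎

    path-from-x : ∀ {k A v B Q} → P k ≡ A ++ v ∷ B → v ≢ x → IsPath G x v Q →
                  Q ≡ A ∷ʳ v ⊎ ∃[ j ] (σsum σ Q ≡ σP j + σsum σ (v ∷ B))
    path-from-x _ v≢x (single _ , _) = ⊥-elim (v≢x refl)
    path-from-x {k} {A} {v} {B} e v≢x path@(step adj _ , _) with edge-at-x adj
    ... | i , S , eS with follow (subst (Unbranched G) eS (P-unbranched i)) path
    ...   | inj₂ (R , e′) = inj₂ (i , through-y e path (trans (cong (_++ R) eS) e′))
    ...   | inj₁ (R , e′) with v ≟ y
    ...     | yes refl with y-is-last e
    ...       | refl = inj₂ (i , trans (cong (σsum σ) (walk-to-y-prefix (proj₁ path) (trans e′ (sym eS))))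
                                       (sym (+-identityʳ (σP i))))
    path-from-x {k} {A} {v} {B} e v≢x path@(step adj _ , _) | i , S , eS | inj₁ (R , e′) | no v≢y
      with on-one-path (walk-end-∈-extension (proj₁ path) (trans e′ (sym eS))) (∈-split A B e) v≢x v≢y
    ...     | refl = inj₁ (prefix-walk-ending-at (P-unique k) e (proj₁ path) (trans e′ (sym eS)))

    -- The detour weighs σ(A u) + σ(P j) + σ(v B) = 0, while σ(P k) = σ(A u) + σ(u v) + σ(v B).
    detour-sign : ∀ {k A u v B R} → P k ≡ A ++ u ∷ v ∷ B → IsPath G x v (x ∷ R) →
                  x ∷ R ≢ (A ∷ʳ u) ∷ʳ v → σsum σ (A ∷ʳ u) + σsum σ (x ∷ R) ≡ + 0 →
                  ∃[ j ] (signToℤ (sgn σ u v) ≡ σP k + σP j)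
    detour-sign {k} {A} {u} {v} {B} eP path not-prefix detour≡0
      with path-from-x (trans eP (sym (++-assoc A [ u ] (v ∷ B)))) v≢x path
      where
        v≢x : v ≢ x
        v≢x v≡x = path-start-has-no-predecessor (paths k) (subst (λ z → Consec u z (P k)) v≡x (subst (Consec u v) (sym eP) (consec-++ʳ A here)))
    ... | inj₁ prefix = ⊥-elim (not-prefix prefix)
    ... | inj₂ (j , h) = j , (begin
      signToℤ (sgn σ u v)                     ≡⟨ cancel-detour α _ β (σP j) (trans (cong (λ z → α + z) (sym h)) detour≡0) ⟩
      (α + (signToℤ (sgn σ u v) + β)) + σP j  ≡⟨ cong (_+ σP j) (sym (trans (cong (σsum σ) eP) (σsum-++ σ A u (v ∷ B)))) ⟩
      σP k + σP j                             ∎)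
      where
        open ≡-Reasoning
        α = σsum σ (A ∷ʳ u)
        β = σsum σ (v ∷ B)

    first-edge-sign : ∀ {k v B Q} → P k ≡ x ∷ v ∷ B → IsPath G x v Q → σsum σ Q ≡ + 0 →
                      ∃[ j ] (signToℤ (sgn σ x v) ≡ σP k + σP j)
    first-edge-sign {v = v} eP path Q≡0 with walk-start (proj₁ path)
    ... | R , refl = detour-sign {A = []} eP path (λ eq → edge-sum-nonzero σ x v (trans (cong (σsum σ) (sym eq)) Q≡0))
                                 (trans (+-identityˡ _) Q≡0)

    inner-edge-sign : ∀ {k A u v B Q} → P k ≡ (x ∷ A) ++ u ∷ v ∷ B → IsPath G u v Q → σsum σ Q ≡ + 0 →
                      ∃[ j ] (signToℤ (sgn σ u v) ≡ σP k + σP j)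
    inner-edge-sign {A = A} {u} {v} {B} {Q} eP path Q≡0 with ∷ʳ-uncons (reverse A) x
    ... | p , S , eS with leaves-backwards (reverse-around x A u v B eP eS) path
                            (λ eq → edge-sum-nonzero σ u v (trans (cong (σsum σ) (sym eq)) Q≡0))
    ...   | R , e′ = detour-sign {A = x ∷ A} eP path′ not-prefix detour≡0
      where
        open ≡-Reasoning
        Q≡ : (u ∷ reverse A) ++ x ∷ R ≡ Q
        Q≡ = trans (cong (u ∷_) (trans (sym (++-assoc (reverse A) [ x ] R)) (cong (_++ R) eS))) e′
        unique′ : Unique ((u ∷ reverse A) ++ x ∷ R)
        unique′ = subst Unique (sym Q≡) (proj₂ path)
        path′ : IsPath G x v (x ∷ R)
        path′ = path-suffix (u ∷ reverse A) (subst (IsPath G u v) (sym Q≡) path)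
        not-prefix : x ∷ R ≢ ((x ∷ A) ∷ʳ u) ∷ʳ v
        not-prefix eq = Unique-++-disjoint (u ∷ reverse A) unique′ (here refl)
                          (subst (u ∈_) (sym eq) (∈-++⁺ˡ (∈-++⁺ʳ (x ∷ A) (here refl))))
        detour≡0 : σsum σ ((x ∷ A) ∷ʳ u) + σsum σ (x ∷ R) ≡ + 0
        detour≡0 = begin
          σsum σ ((x ∷ A) ∷ʳ u) + σsum σ (x ∷ R)            ≡⟨ cong (_+ σsum σ (x ∷ R)) (sym (σsum-reverse σ ((x ∷ A) ∷ʳ u))) ⟩
          σsum σ (reverse ((x ∷ A) ∷ʳ u)) + σsum σ (x ∷ R)  ≡⟨ cong (λ L → σsum σ L + σsum σ (x ∷ R)) (reverse-∷-∷ʳ x A u) ⟩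
          σsum σ ((u ∷ reverse A) ∷ʳ x) + σsum σ (x ∷ R)    ≡⟨ sym (σsum-++ σ (u ∷ reverse A) x R) ⟩
          σsum σ ((u ∷ reverse A) ++ x ∷ R)                 ≡⟨ cong (σsum σ) Q≡ ⟩
          σsum σ Q                                          ≡⟨ Q≡0 ⟩
          + 0                                               ∎

    edge-sign : ∀ {k u v} → Consec u v (P k) → DistZero σ u v → ∃[ j ] (signToℤ (sgn σ u v) ≡ σP k + σP j)
    edge-sign {k} uv (Q , path , ∣Q∣≡0) with consec-split uv | walk-start (P-walk k)
    ... | [] , B , eP | _ , eT with ∷-injective (trans (sym eP) eT)
    ...   | refl , _ = first-edge-sign eP path (∣i∣≡0⇒i≡0 ∣Q∣≡0)
    edge-sign {k} uv (Q , path , ∣Q∣≡0) | (_ ∷ A) , B , eP | _ , eT with ∷-injective (trans (sym eP) eT)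
    ...   | refl , _ = inner-edge-sign eP path (∣i∣≡0⇒i≡0 ∣Q∣≡0)

    xy-path-weight : ∀ {Q} → IsPath G x y Q → ∃[ j ] (σsum σ Q ≡ σP j)
    xy-path-weight path with cover-vertices y
    ... | k , _ with walk-end (P-walk k)
    ...   | Z , eZ with path-from-x eZ (endpoints-distinct ∘ sym) path
    ...     | inj₁ Q≡ = k , cong (σsum σ) (trans Q≡ (sym eZ))
    ...     | inj₂ (j , h) = j , trans h (+-identityʳ (σP j))

    module _ (W : WZero σ) where

      zero-weight-path : ∃[ a ] (σP a ≡ + 0)
      zero-weight-path with W x y
      ... | Q , path , ∣Q∣≡0 with xy-path-weight path
      ...   | a , h = a , trans (sym h) (∣i∣≡0⇒i≡0 ∣Q∣≡0)

      unit-weight-path : ∀ c → ∃[ j ] (σP j ≡ signToℤ c)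
      unit-weight-path c with zero-weight-path
      ... | a , a≡0 with zero-walk-has-edge-of-sign σ c endpoints-distinct (P-walk a) a≡0
      ...   | u , v , uv , uv≡c with edge-sign uv (W u v)
      ...     | j , h = j , (begin
        σP j                 ≡⟨ sym (+-identityˡ (σP j)) ⟩
        + 0 + σP j           ≡⟨ cong (_+ σP j) (sym a≡0) ⟩
        σP a + σP j          ≡⟨ sym h ⟩
        signToℤ (sgn σ u v)  ≡⟨ cong signToℤ uv≡c ⟩
        signToℤ c            ∎)
        where open ≡-Reasoning

      some-weight-beyond-unit : ¬ (∀ j → SignOrZero (σP j))
      some-weight-beyond-unit unit = s≢opposite[s] Sign.+ (trans (sym (sign-x-y Sign.+)) (sign-x-y Sign.-))
        where
          sign-x-y : ∀ c → sgn σ x y ≡ c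
          sign-x-y c with unit-weight-path c
          ... | j , j≡c = monochromatic-walk-sign σ c (P-walk j) edge-has-sign-c j≡c
            where
              edge-has-sign-c : ∀ {u v} → Consec u v (P j) → sgn σ u v ≡ c
              edge-has-sign-c {u} {v} uv with edge-sign uv (W u v)
              ... | i , h = sign-forced c (sgn σ u v) (σP i) (unit i) (trans h (cong (_+ σP i) j≡c))

      unit-weights : t ≤ 3 → ∀ j → SignOrZero (σP j)
      unit-weights t≤3 j with zero-weight-path | unit-weight-path Sign.+ | unit-weight-path Sign.-
      ... | a , a≡0 | j₊ , j₊≡1 | j₋ , j₋≡-1
        with three-cover t≤3 (weights-differ a≡0 j₊≡1 λ ()) (weights-differ a≡0 j₋≡-1 λ ()) (weights-differ j₊≡1 j₋≡-1 λ ()) j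
        where
          weights-differ : ∀ {i k p q} → σP i ≡ p → σP k ≡ q → p ≢ q → i ≢ k
          weights-differ i≡p k≡q p≢q refl = p≢q (trans (sym i≡p) k≡q)
      ...   | inj₁ refl        = inj₁ a≡0
      ...   | inj₂ (inj₁ refl) = inj₂ (Sign.+ , j₊≡1)
      ...   | inj₂ (inj₂ refl) = inj₂ (Sign.- , j₋≡-1)

lemma3p3 : ∀ {n : ℕ} (G : SimpleGraph n) (x y : Fin n) (t : ℕ)
           (P : Fin t → List (Fin n)) →
           ConsistsOfPaths G x y t P → t ≤ 3 → ¬ Canceling G
lemma3p3 G x y t P C t≤3 (σ , W) = some-weight-beyond-unit σ W (unit-weights σ W t≤3)
  where open ThetaGraph C
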